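{- Every deterministic algorithm that is correct for all winner-only Stone Game III inputs has worst-case time $\Omega(n)$. That is, for every deterministic algorithm in the random-access input model that, for every $n$ and every integer input $(v_0,\ldots,v_{n-1})$ whose Stone Game III outcome is not a tie, outputs the correct winner in $\{\texttt{Alice},\texttt{Bob}\}$, the worst-case running time over the winner-only inputs of length $n$ is $\Omega(n)$.
   Context: Stone Game III: a row of $n$ stones has integer values $v_0,v_1,\ldots,v_{n-1}$. Alice and Bob alternate turns, Alice moving first. On each turn a player removes the first one, two, or three remaining stones (no more than remain) and adds their values to his or her own score. Play ends when no stones remain. Both players know all values and play optimally (each maximizes own final score, equivalently own score minus the opponent's score). The outcome is $\texttt{Alice}$, $\texttt{Bob}$ or $\texttt{Tie}$ according to the final scores under optimal play (the player with the higher score wins; equal scores are a tie). Winner-only variant (promise problem): the input is guaranteed to have a winner, i.e. the outcome under optimal play is not $\texttt{Tie}$. The algorithm need only distinguish $\texttt{Alice}$ from $\texttt{Bob}$, and it is required to be correct only on inputs satisfying this promise. Random-access input model (deterministic query / decision-tree model): the length $n$ is known, and a deterministic algorithm may inspect any chosen position $i$, learning $v_i$, at unit cost. The choice of the next position may depend on all values inspected so far. Other unit-cost arithmetic and control operations are allowed. The algorithm's execution and output on an input depend on that input only through $n$ and the values inspected. Each inspection costs at least one unit of time, so the running time is at least the number of inspections. -}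

module Defs where

open import Data.Fin using (Fin)
open import Data.Integer using (ℤ; +_; 0ℤ; _+_)
open import Data.Integer.Properties using (<-cmp; ≤-totalOrder)
open import Data.List using ([]; _∷_)
open import Data.List.Extrema ≤-totalOrder using (argmax)
open import Data.Nat using (ℕ; zero; suc)
import Data.Nat as ℕ
open import Data.Product using (_×_; _,_; proj₁; ∃-syntax)
import Data.Rational.Unnormalised as ℚ
open ℚ using (ℚᵘ; 0ℚᵘ)
open import Data.Vec using (Vec; []; _∷_; lookup)
open import Relation.Binary using (tri<; tri≈; tri>)
open import Relation.Binary.PropositionalEquality using (_≡_; _≢_)

data Player : Set where
  Alice Bob : Player

data Outcome : Set where
  wins : Player → Outcome
  tie  : Outcome

-- Scores collected from the current position to the end of play:
-- (score of the player to move , score of the opponent).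
Scores : Set
Scores = ℤ × ℤ

-- The mover collects a; the roles are then swapped for the remaining stones.
collect : ℤ → Scores → Scores
collect a (next , other) = a + other , next

-- Backward induction: the mover picks a legal move maximizing the mover's own
-- final score.  How argmax breaks ties is immaterial, since the two scores
-- always add up to the total value of the remaining stones.
optimalScores : ∀ {n} → Vec ℤ n → Scores
optimalScores []            = 0ℤ , 0ℤ
optimalScores (x ∷ [])      = collect x (optimalScores [])
optimalScores (x ∷ y ∷ [])  =
  argmax proj₁
    (collect x       (optimalScores (y ∷ [])))
    (collect (x + y) (optimalScores []) ∷ [])
optimalScores (x ∷ y ∷ z ∷ vs) =
  argmax proj₁
    (collect x           (optimalScores (y ∷ z ∷ vs)))
    (collect (x + y)     (optimalScores (z ∷ vs)) ∷
     collect (x + y + z) (optimalScores vs) ∷ [])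

compareScores : Scores → Outcome
compareScores (alice , bob) with <-cmp alice bob
... | tri< _ _ _ = wins Bob
... | tri≈ _ _ _ = tie
... | tri> _ _ _ = wins Alice

outcome : ∀ {n} → Vec ℤ n → Outcome
outcome v = compareScores (optimalScores v)

HasWinner : ∀ {n} → Vec ℤ n → Set
HasWinner v = outcome v ≢ tie

data Action (n : ℕ) (S : Set) : Set where
  output  : Player → Action n S
  compute : S → Action n S
  inspect : Fin n → (ℤ → S) → Action n S

-- A deterministic algorithm is an arbitrary transition system that knows n and
-- meets the input only through inspect.  It need not halt on every input.
record Algorithm : Set₁ where
  field
    State : ℕ → Set
    start : ∀ n → State n
    next  : ∀ n → State n → Action n (State n)

open Algorithm public

-- Run A v a t p: performing action a and continuing from there on input v, A
-- halts with output p after t units of time.  Announcing the output is free.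
data Run (A : Algorithm) {n} (v : Vec ℤ n) :
         Action n (State A n) → ℕ → Player → Set where
  halted    : ∀ {p} → Run A v (output p) zero p
  computed  : ∀ {s t p} → Run A v (next A n s) t p →
              Run A v (compute s) (suc t) p
  inspected : ∀ {i k t p} → Run A v (next A n (k (lookup v i))) t p →
              Run A v (inspect i k) (suc t) p

HaltsWith : Algorithm → ∀ {n} → Vec ℤ n → ℕ → Player → Set
HaltsWith A {n} v t p = Run A v (next A n (start A n)) t p

CorrectOnWinnerInputs : Algorithm → Set
CorrectOnWinnerInputs A =
  ∀ n (v : Vec ℤ n) p → outcome v ≡ wins p → ∃[ t ] HaltsWith A v t p

fromℕ : ℕ → ℚᵘ
fromℕ n = + n ℚ./ 1

-- The worst-case running time over winner-only inputs of length n is a supremum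
-- of naturals and may be infinite; it is at least r > 0 exactly when some such
-- input has running time at least r.
WorstCaseTime≥ : Algorithm → ℕ → ℚᵘ → Set
WorstCaseTime≥ A n r =
  ∃[ v ] HasWinner {n} v × ∃[ t ] ∃[ p ] HaltsWith A v t p × r ℚ.≤ fromℕ t

WorstCaseTimeΩ : Algorithm → (ℕ → ℕ) → Set
WorstCaseTimeΩ A g =
  ∃[ c ] (0ℚᵘ ℚ.< c) ×
    ∃[ n₀ ] (∀ n → n₀ ℕ.≤ n → WorstCaseTime≥ A n (c ℚ.* fromℕ (g n)))

{-# OPTIONS --safe #-}

-- Sensitivity argument.  On (1,0,…,0) Alice wins.  If instead the stone at a
-- position i ≡ 3 (mod 4) is worth 2, then Bob can always be the one to take it,
-- by answering each removal of k stones with 4 − k, and he wins 2 to 1.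
-- A correct algorithm run on (1,0,…,0) must therefore inspect every such position.
module Submission where

open import Defs
open import Data.Fin using (Fin; zero; suc; toℕ; fromℕ<)
open import Data.Fin.Properties using (toℕ<n; toℕ-fromℕ<; toℕ-injective; suc-injective; injective⇒≤)
  renaming (_≟_ to _≟ᶠ_)
open import Data.Integer as ℤ using (ℤ; +_; 0ℤ; 1ℤ; +≤+; +<+)
import Data.Integer.Properties as ℤ
open import Data.List as List using (List; []; _∷_; length)
open import Data.List.Extrema ℤ.≤-totalOrder using (argmax)
import Data.List.Membership.DecPropositional as DecMembership
open import Data.List.Membership.Propositional using (_∈_)
open import Data.List.Relation.Unary.Any using (here; there; index)
open import Data.List.Relation.Unary.Any.Properties using (lookup-index)
open import Data.Nat using (ℕ; zero; suc; _+_; _*_; _/_; _%_; _≤_; _<_; z≤n; s≤s)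
open import Data.Nat.DivMod using (m/n*n≤m; m%n<n; m≡m%n+[m/n]*n)
open import Data.Nat.Properties using (≤-trans; ≤-pred; <⇒≤; m≤m+n; m≤n⇒m≤1+n;
  +-comm; +-mono-≤; +-monoʳ-≤; *-monoˡ-≤; *-monoʳ-≤; *-cancelʳ-≡; module ≤-Reasoning)
open import Data.Product using (_,_; proj₁)
import Data.Rational.Unnormalised as ℚ
open import Data.Vec using (Vec; _∷_; lookup; replicate; _[_]≔_)
open import Data.Vec.Properties using (lookup∘update′)
open import Function using (_∘_)
open import Relation.Binary.PropositionalEquality using (_≡_; _≢_; refl; sym; trans; cong; subst; subst₂)
open import Relation.Nullary using (yes; no; contradiction)

inspections : ∀ {A n} {v : Vec ℤ n} {a t p} → Run A v a t p → List (Fin n)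
inspections halted                = []
inspections (computed r)          = inspections r
inspections (inspected {i = i} r) = i ∷ inspections r

length-inspections : ∀ {A n} {v : Vec ℤ n} {a t p} (r : Run A v a t p) →
                     length (inspections r) ≤ t
length-inspections halted        = z≤n
length-inspections (computed r)  = m≤n⇒m≤1+n (length-inspections r)
length-inspections (inspected r) = s≤s (length-inspections r)

-- An action's continuation depends on the input only through the value inspected, so the second run
-- is forced to follow the first step by step. Agreement is needed only where the first run looks.
agreeing-runs : ∀ {A n} {v w : Vec ℤ n} {a t u p q}
                (r : Run A v a t p) → Run A w a u q →
                (∀ {i} → i ∈ inspections r → lookup v i ≡ lookup w i) →
                p ≡ q
agreeing-runs halted       halted       _ = refl
agreeing-runs (computed r) (computed s) e = agreeing-runs r s e
agreeing-runs {A} {n} {w = w} (inspected {k = k} r) (inspected {t = u} {p = q} s) e =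
  agreeing-runs r
    (subst (λ x → Run A w (next A n (k x)) u q) (sym (e (here refl))) s)
    (e ∘ there)

-- Pigeonhole: looking up the index of a membership proof recovers the element, so
-- `i ↦ index (f∈xs i)` is injective into the positions of `xs`.
injection-into-list : ∀ {X : Set} {m} (xs : List X) (f : Fin m → X) →
                      (∀ {i j} → f i ≡ f j → i ≡ j) → (∀ i → f i ∈ xs) →
                      m ≤ length xs
injection-into-list xs f f-inj f∈xs =
  injective⇒≤ {f = λ i → index (f∈xs i)} λ {i} {j} eq → f-inj
    (trans (lookup-index (f∈xs i))
      (trans (cong (List.lookup xs) eq) (sym (lookup-index (f∈xs j)))))

sensitive-positions≤time :
  ∀ (A : Algorithm) {n m t p q} (v : Vec ℤ n) → CorrectOnWinnerInputs A →
  HaltsWith A v t p → p ≢ q →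
  (x : ℤ) (pos : Fin m → Fin n) → (∀ {i j} → pos i ≡ pos j → i ≡ j) →
  (∀ j → outcome (v [ pos j ]≔ x) ≡ wins q) →
  m ≤ t
sensitive-positions≤time A {n} {q = q} v correct run p≢q x pos pos-inj flips =
  ≤-trans (injection-into-list (inspections run) pos pos-inj inspects)
          (length-inspections run)
  where
  inspects : ∀ j → pos j ∈ inspections run
  inspects j with DecMembership._∈?_ _≟ᶠ_ (pos j) (inspections run)
  ... | yes i∈ = i∈
  -- Correctness makes `A` halt with `q` on the altered input, but if `pos j` is never inspected,
  -- that run copies `run` and outputs `p`.
  ... | no  i∉ with _ , run′ ← correct n (v [ pos j ]≔ x) q (flips j) =
    contradiction
      (agreeing-runs run run′ λ {i} i∈ →
        sym (lookup∘update′ (λ i≡ → i∉ (subst (_∈ inspections run) i≡ i∈)) v x))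
      p≢q

bestOfThree : ℤ → ℤ → ℤ → Scores → Scores → Scores → Scores
bestOfThree x y z s₁ s₂ s₃ =
  argmax proj₁
    (collect x s₁)
    (collect (x ℤ.+ y) s₂ ∷ collect (x ℤ.+ y ℤ.+ z) s₃ ∷ [])

-- Once the scores of the three suffixes are replaced by known values, `bestOfThree` can often be
-- settled by evaluation, although the length stays a variable.
optimalScores-step : ∀ {n} x y z (vs : Vec ℤ n) {s₁ s₂ s₃} →
                     optimalScores (y ∷ z ∷ vs) ≡ s₁ →
                     optimalScores (z ∷ vs) ≡ s₂ →
                     optimalScores vs ≡ s₃ →
                     optimalScores (x ∷ y ∷ z ∷ vs) ≡ bestOfThree x y z s₁ s₂ s₃
optimalScores-step x y z vs refl refl refl = refl

outcome-scores : ∀ {n} (v : Vec ℤ n) {s} → optimalScores v ≡ s →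
                 outcome v ≡ compareScores s
outcome-scores v refl = refl

zeros : ∀ n → Vec ℤ n
zeros n = replicate n 0ℤ

optimalScores-zeros : ∀ n → optimalScores (zeros n) ≡ (0ℤ , 0ℤ)
optimalScores-zeros 0 = refl
optimalScores-zeros 1 = refl
optimalScores-zeros 2 = refl
optimalScores-zeros (suc (suc (suc n))) =
  optimalScores-step 0ℤ 0ℤ 0ℤ (zeros n)
    (optimalScores-zeros (suc (suc n)))
    (optimalScores-zeros (suc n))
    (optimalScores-zeros n)

-- Optimal scores when the only nonzero stone, worth 2, has k stones before it.
prizeScores : ℕ → Scores
prizeScores 0 = + 2 , 0ℤ
prizeScores 1 = + 2 , 0ℤ
prizeScores 2 = + 2 , 0ℤ
prizeScores 3 = 0ℤ , + 2
prizeScores (suc (suc (suc (suc k)))) = prizeScores k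

-- Both sides have period 4 in `k` by definition, so evaluating one period suffices.
prizeScores-step : ∀ k → bestOfThree 0ℤ 0ℤ 0ℤ
                           (prizeScores (2 + k)) (prizeScores (1 + k)) (prizeScores k)
                         ≡ prizeScores (3 + k)
prizeScores-step 0 = refl
prizeScores-step 1 = refl
prizeScores-step 2 = refl
prizeScores-step 3 = refl
prizeScores-step (suc (suc (suc (suc k)))) = prizeScores-step k

-- With the multiple of 4 on the left of the sum, `suc j * 4 + r` unfolds to four successors, and
-- the last clause of `prizeScores` applies by computation.
prizeScores-*4 : ∀ r j → prizeScores (j * 4 + r) ≡ prizeScores r
prizeScores-*4 r zero    = refl
prizeScores-*4 r (suc j) = prizeScores-*4 r j

-- If the prize is among the first three stones, the mover can take it at once, and the suffixes
-- beyond it are all zeros. Otherwise the three front stones are worthless and only the distance to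
-- the prize matters.
optimalScores-prize : ∀ {n} (i : Fin n) →
                      optimalScores (zeros n [ i ]≔ + 2) ≡ prizeScores (toℕ i)
optimalScores-prize {1} zero = refl
optimalScores-prize {2} zero = refl
optimalScores-prize {2} (suc zero) = refl
optimalScores-prize {suc (suc (suc n))} zero =
  optimalScores-step (+ 2) 0ℤ 0ℤ (zeros n)
    (optimalScores-zeros (suc (suc n)))
    (optimalScores-zeros (suc n))
    (optimalScores-zeros n)
optimalScores-prize {suc (suc (suc n))} (suc zero) =
  optimalScores-step 0ℤ (+ 2) 0ℤ (zeros n)
    (optimalScores-prize {suc (suc n)} zero)
    (optimalScores-zeros (suc n))
    (optimalScores-zeros n)
optimalScores-prize {suc (suc (suc n))} (suc (suc zero)) =
  optimalScores-step 0ℤ 0ℤ (+ 2) (zeros n)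
    (optimalScores-prize {suc (suc n)} (suc zero))
    (optimalScores-prize {suc n} zero)
    (optimalScores-zeros n)
optimalScores-prize {suc (suc (suc n))} (suc (suc (suc i))) =
  trans
    (optimalScores-step 0ℤ 0ℤ 0ℤ (zeros n [ i ]≔ + 2)
      (optimalScores-prize (suc (suc i)))
      (optimalScores-prize (suc i))
      (optimalScores-prize i))
    (prizeScores-step (toℕ i))

base : ∀ m → Vec ℤ (3 + m)
base m = 1ℤ ∷ 0ℤ ∷ 0ℤ ∷ zeros m

base-scores : ∀ m → optimalScores (base m) ≡ (1ℤ , 0ℤ)
base-scores m =
  optimalScores-step 1ℤ 0ℤ 0ℤ (zeros m)
    (optimalScores-zeros (2 + m))
    (optimalScores-zeros (1 + m))
    (optimalScores-zeros m)

base-outcome : ∀ m → outcome (base m) ≡ wins Alice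
base-outcome m = outcome-scores (base m) (base-scores m)

flipped : ∀ {m} → Fin m → Vec ℤ (3 + m)
flipped {m} i = base m [ suc (suc (suc i)) ]≔ + 2

-- Each of Alice's three moves collects the 1 and leaves 2, 1 or 0 stones modulo 4 before the prize.
-- In all three cases the next mover, Bob, gets it.
flipped-scores : ∀ {m} (i : Fin m) j → toℕ i ≡ j * 4 →
                 optimalScores (flipped i) ≡ (1ℤ , + 2)
flipped-scores {m} i j i≡4j =
  optimalScores-step 1ℤ 0ℤ 0ℤ (zeros m [ i ]≔ + 2)
    (trans (optimalScores-prize (suc (suc i))) (period 2))
    (trans (optimalScores-prize (suc i)) (period 1))
    (trans (optimalScores-prize i) (period 0))
  where
  period : ∀ r → prizeScores (r + toℕ i) ≡ prizeScores r
  period r = trans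
    (cong prizeScores (trans (cong (λ x → r + x) i≡4j) (+-comm r (j * 4))))
    (prizeScores-*4 r j)

flipped-outcome : ∀ {m} (i : Fin m) j → toℕ i ≡ j * 4 →
                  outcome (flipped i) ≡ wins Bob
flipped-outcome i j i≡4j = outcome-scores (flipped i) (flipped-scores i j i≡4j)

fourfold< : ∀ k (j : Fin (suc (k / 4))) → toℕ j * 4 < suc k
fourfold< k j = s≤s (≤-trans (*-monoˡ-≤ 4 (≤-pred (toℕ<n j))) (m/n*n≤m k 4))

fourfold : ∀ k → Fin (suc (k / 4)) → Fin (suc k)
fourfold k j = fromℕ< (fourfold< k j)

toℕ-fourfold : ∀ k j → toℕ (fourfold k j) ≡ toℕ j * 4
toℕ-fourfold k j = toℕ-fromℕ< (fourfold< k j)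

base-winner : ∀ m → HasWinner (base m)
base-winner m eq with () ← trans (sym (base-outcome m)) eq

-- The map `f` is known only through its values, which already give injectivity; its construction by
-- division stays out of the argument.
fourfold-bound : ∀ (A : Algorithm) {m c t} → CorrectOnWinnerInputs A →
                 HaltsWith A (base m) t Alice →
                 (f : Fin c → Fin m) → (∀ j → toℕ (f j) ≡ toℕ j * 4) → c ≤ t
fourfold-bound A {m} correct run f f≡4j =
  sensitive-positions≤time A (base m) correct run (λ ()) (+ 2)
    (λ j → suc (suc (suc (f j))))
    (f-injective ∘ suc-injective ∘ suc-injective ∘ suc-injective)
    (λ j → flipped-outcome (f j) (toℕ j) (f≡4j j))
  where
  f-injective : ∀ {i j} → f i ≡ f j → i ≡ j
  f-injective {i} {j} eq = toℕ-injective (*-cancelʳ-≡ _ _ 4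
    (trans (sym (f≡4j i)) (trans (cong toℕ eq) (f≡4j j))))

-- For length `n = 4 + k` there are `1 + k / 4`, that is ⌊n/4⌋, positions congruent to 3 modulo 4.
-- This is at least n/8, the source of the constant 1/8.
4+k≤8[1+k/4] : ∀ k → 4 + k ≤ suc (k / 4) * 8
4+k≤8[1+k/4] k = begin
  4 + k                    ≡⟨ cong (λ x → 4 + x) (m≡m%n+[m/n]*n k 4) ⟩
  4 + (k % 4 + k / 4 * 4)  ≤⟨ +-monoʳ-≤ 4 (+-mono-≤ (<⇒≤ (m%n<n k 4)) (*-monoʳ-≤ (k / 4) 4≤8)) ⟩
  8 + k / 4 * 8            ∎
  where
  open ≤-Reasoning
  4≤8 : 4 ≤ 8
  4≤8 = m≤m+n 4 4

1/8*n≤t : ∀ n t → n ≤ t * 8 → (+ 1 ℚ./ 8) ℚ.* fromℕ n ℚ.≤ fromℕ t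
-- The order on unnormalised rationals is cross-multiplication: the goal is `(1 * n) * 1 ≤ t * 8`
-- over the integers.
1/8*n≤t n t n≤8t = ℚ.*≤* (subst₂ ℤ._≤_
  (trans (sym (ℤ.*-identityˡ (+ n))) (sym (ℤ.*-identityʳ (+ 1 ℤ.* + n))))
  (ℤ.pos-* t 8)
  (+≤+ n≤8t))

worst-case : ∀ (A : Algorithm) {m c} → CorrectOnWinnerInputs A →
             (f : Fin c → Fin m) → (∀ j → toℕ (f j) ≡ toℕ j * 4) → 3 + m ≤ c * 8 →
             WorstCaseTime≥ A (3 + m) ((+ 1 ℚ./ 8) ℚ.* fromℕ (3 + m))
worst-case A {m} correct f f≡4j 3+m≤8c =
  let t , run = correct (3 + m) (base m) Alice (base-outcome m) in
  base m , base-winner m , t , Alice , run ,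
  1/8*n≤t (3 + m) t (≤-trans 3+m≤8c (*-monoˡ-≤ 8 (fourfold-bound A correct run f f≡4j)))

theorem6p3 : (A : Algorithm) → CorrectOnWinnerInputs A → WorstCaseTimeΩ A (λ n → n)
-- The threshold is 4 because position 3, the first one congruent to 3 modulo 4, exists only from
-- that length on.
theorem6p3 A correct = + 1 ℚ./ 8 , ℚ.*<* (+<+ (s≤s z≤n)) , 4 , bound
  where
  bound : ∀ n → 4 ≤ n → WorstCaseTime≥ A n ((+ 1 ℚ./ 8) ℚ.* fromℕ n)
  bound _ (s≤s (s≤s (s≤s (s≤s (z≤n {k}))))) =
    worst-case A correct (fourfold k) (toℕ-fourfold k) (4+k≤8[1+k/4] k)
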